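{- Let $d$ be an integer with $d\ge 4$. (i) If $d$ is even, $n\ge 4d+1$ and $n\equiv 0\pmod 2$, then $\gamma^{SID}(C_n(1,d))=\frac n2$. (ii) If $n\ge 4d+1$ and $n\equiv 0\pmod 2$, then $\gamma^{SID}(C_n(1,d-1,d))=\frac n2$. (iii) If $d\equiv 1\pmod 3$, $n\ge 4d+5$ and $n\equiv 0\pmod 3$, then $\gamma^{SID}(C_n(1,d-1,d,d+1))=\frac n3$.
   Context: All graphs are simple and undirected. For a graph $G=(V,E)$ and $u\in V$, $N[u]=\{u\}\cup\{v: uv\in E\}$. A code is a nonempty $C\subseteq V$, and $I(C;u)=N[u]\cap C$. $C$ is self-identifying if $I(C;u)\setminus I(C;v)\neq\emptyset$ for all distinct $u,v\in V$. $\gamma^{SID}(G)$ is the minimum cardinality of a self-identifying code in a finite graph $G$. For positive integers $n$ and $d_1,\dots,d_k\le n/2$, the circulant graph $C_n(d_1,\dots,d_k)$ has vertex set $\mathbb{Z}_n$, and the open neighbourhood of $u$ is $\{u\pm d_1,\dots,u\pm d_k\}$ modulo $n$. -}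

module Defs where

open import Data.Nat using (ℕ; zero; suc; _+_; _*_; _∸_; _%_; _≤_; NonZero)
open import Data.Fin using (Fin; toℕ)
open import Data.Fin.Subset using (Subset; _∈_; _∉_; ∣_∣; Nonempty)
open import Data.List using (List; _∷_; [])
open import Data.List.Relation.Unary.Any using (Any)
open import Data.Product using (_×_; ∃; ∃-syntax)
open import Data.Sum using (_⊎_)
open import Relation.Binary.PropositionalEquality using (_≡_)
open import Relation.Nullary using (¬_)

record Graph (n : ℕ) : Set₁ where
  field
    Adj       : Fin n → Fin n → Set
    irreflAdj : ∀ u → ¬ Adj u u
    symAdj    : ∀ u v → Adj u v → Adj v u
open Graph public

InClosedNbhd : ∀ {n} → Graph n → Fin n → Fin n → Set
InClosedNbhd G u v = (u ≡ v) ⊎ Adj G u v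

SelfIdentifying : ∀ {n} → Graph n → Subset n → Set
SelfIdentifying {n} G C =
  Nonempty C ×
  (∀ (u v : Fin n) → ¬ (u ≡ v) →
     ∃[ c ] (c ∈ C × InClosedNbhd G u c × ¬ InClosedNbhd G v c))

γSID≡ : ∀ {n} → Graph n → ℕ → Set
γSID≡ {n} G k =
  (∃[ C ] (SelfIdentifying G C × ∣ C ∣ ≡ k)) ×
  (∀ (C : Subset n) → SelfIdentifying G C → k ≤ ∣ C ∣)

-- Circulant adjacency on ℤ_n (n > 0), vertices represented by 0..n-1:
-- v ≡ u + d or u ≡ v + d (mod n), for some d in the list, and u ≠ v.
-- a ≡ b + d (mod n) is expressed as: ∃ k, b + d ≡ a + k * n  (with 0 ≤ a < n).
CircAdj : (n : ℕ) → List ℕ → Fin n → Fin n → Set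
CircAdj n ds u v =
  ¬ (u ≡ v) ×
  Any (λ d → (∃[ k ] (toℕ u + d ≡ toℕ v + k * n)) ⊎
             (∃[ k ] (toℕ v + d ≡ toℕ u + k * n))) ds

open import Data.Product using (_,_)
open import Data.Sum using (inj₁; inj₂)
open import Data.List.Relation.Unary.Any using (map)
open import Relation.Binary.PropositionalEquality using (sym)

private
  swap⊎ : ∀ {a b : Set} → a ⊎ b → b ⊎ a
  swap⊎ (inj₁ x) = inj₂ x
  swap⊎ (inj₂ y) = inj₁ y

Circulant : (n : ℕ) → List ℕ → Graph n
Circulant n ds = record
  { Adj       = CircAdj n ds
  ; irreflAdj = λ u a → proj₁ a _≡_.refl
  ; symAdj    = λ u v a → (λ e → proj₁ a (sym e)) , map swap⊎ (proj₂ a)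
  }
  where open Data.Product using (proj₁; proj₂)

{-# OPTIONS --safe #-}

-- Lower bounds, by double counting over all translates of a local inequality. A codeword is needed
-- in N[u] ∖ N[v] for each neighbour v of u. In C_n(1,d) this puts a codeword among any three of the
-- four neighbours of u, hence two among the four. In C_n(1,d-1,d), a triangular grid, it hits any
-- three consecutive neighbours of u; so u has at least two neighbours in the code, and at least four
-- if u is not a codeword itself, and the average over u gives density 1/2. In C_n(1,d-1,d,d+1),
-- a king's grid, it hits each column of three vertices.
--
-- Upper bounds: the code is the set of multiples of p (p = 2, 2, 3). If v also reaches two codewords
-- of N[u], at offsets a and a′ from u and o and o′ from v, then o + a′ ≡ o′ + a (mod n). Offsets
-- shifted to be nonnegative are at most 2K, where K is the largest generator, and n > 4K, so this is
-- an equality of integers that are linear in d; whether it can hold is decided by computation on the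
-- coefficients.
module Submission where

open import Defs
open import Data.Bool using (Bool; true; false; T; _∨_; if_then_else_)
open import Data.Bool.ListAction using (any)
open import Data.Bool.Properties using (T-≡)
open import Data.Empty using (⊥-elim)
open import Data.Fin using (Fin; toℕ; fromℕ<) renaming (zero to fzero; suc to fsuc)
open import Data.Fin.Properties using (toℕ-fromℕ<; toℕ-injective; toℕ<n) renaming (_≟_ to _≟ᶠ_)
open import Data.Fin.Subset using (Subset; _∈_; ∣_∣)
open import Data.List using (List; _∷_; []; map; length; upTo)
open import Data.List.Membership.Propositional using (find) renaming (_∈_ to _∈ˡ_)
open import Data.List.Membership.Propositional.Properties using (∈-upTo⁺)
open import Data.List.Properties using (map-cong; length-upTo; length-map)
open import Data.List.Relation.Unary.All using (All; []; _∷_; all?)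
import Data.List.Relation.Unary.All as All
import Data.List.Relation.Unary.Any as Any
open import Data.List.Relation.Unary.Any using (Any; here; there; any?)
open import Data.List.Relation.Unary.Any.Properties using (any⁺)
open import Data.Nat using (ℕ; zero; suc; pred; _+_; _*_; _∸_; _≤_; _<_; _%_; _/_; z≤n; s≤s; NonZero; _≟_; _≤?_; _<?_; >-nonZero)
open import Data.Nat.Divisibility using (_∣_; m%n≡0⇒n∣m)
open import Data.Nat.DivMod
open import Data.Nat.ListAction using (sum)
open import Data.Nat.Properties hiding (_≟_; _≤?_; _<?_)
open import Data.Nat.Tactic.RingSolver using (solve-∀)
open import Data.Product using (_×_; _,_; ∃-syntax; proj₁; proj₂)
open import Data.Product.Properties using (≡-dec)
open import Data.Sum using (_⊎_; inj₁; inj₂)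
open import Data.Vec using (lookup; tabulate; []; _∷_)
open import Data.Vec.Properties using ([]=⇒lookup; lookup⇒[]=; lookup∘tabulate)
open import Function using (_∘_; Equivalence)
open import Relation.Binary.PropositionalEquality
open import Relation.Nullary using (¬_; Dec; yes; no; does; contradiction)
open import Relation.Nullary.Decidable using (True; toWitness; dec-true; _×-dec_; _⊎-dec_)

-- Arithmetic of natural numbers modulo n.

module Congruence (n : ℕ) .{{_ : NonZero n}} where

  infix 4 _≈_
  _≈_ : ℕ → ℕ → Set
  a ≈ b = a % n ≡ b % n

  ≡⇒≈ : ∀ {a b} → a ≡ b → a ≈ b
  ≡⇒≈ = cong (_% n)

  %-≈ : ∀ a → a ≈ a % n
  %-≈ a = sym (m%n%n≡m%n a n)

  ≈⇒≡ : ∀ {a b} → a < n → b < n → a ≈ b → a ≡ b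
  ≈⇒≡ a<n b<n a≈b = trans (sym (m<n⇒m%n≡m a<n)) (trans a≈b (m<n⇒m%n≡m b<n))

  +-cong-≈ : ∀ {a b c d} → a ≈ b → c ≈ d → a + c ≈ b + d
  +-cong-≈ {a} {b} {c} {d} p q = trans (%-distribˡ-+ a c n)
    (trans (cong₂ (λ x y → (x + y) % n) p q) (sym (%-distribˡ-+ b d n)))

  *-cong-≈ : ∀ {a b c d} → a ≈ b → c ≈ d → a * c ≈ b * d
  *-cong-≈ {a} {b} {c} {d} p q = trans (%-distribˡ-* a c n)
    (trans (cong₂ (λ x y → (x * y) % n) p q) (sym (%-distribˡ-* b d n)))

  -- `c * pred n` serves as -c modulo `n`, because c + c(n - 1) = cn; this gives subtraction without
  -- leaving ℕ.
  +-inverse-≈ : ∀ a c → a + c + c * pred n ≈ a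
  +-inverse-≈ a c = trans (≡⇒≈ eq) ([m+kn]%n≡m%n a c n)
    where
    eq : a + c + c * pred n ≡ a + c * n
    eq = trans (+-assoc a c _) (cong (a +_) (trans (sym (*-suc c (pred n))) (cong (c *_) (suc-pred n))))

  +-cancelʳ-≈ : ∀ {a b} c → a + c ≈ b + c → a ≈ b
  +-cancelʳ-≈ {a} {b} c p =
    trans (sym (+-inverse-≈ a c)) (trans (+-cong-≈ {a + c} {b + c} p refl) (+-inverse-≈ b c))

+-swapʳ : ∀ a b c → a + b + c ≡ a + c + b
+-swapʳ = solve-∀

-- Finite sums and their invariance under translation.

∑ : ℕ → (ℕ → ℕ) → ℕ
∑ zero    f = 0
∑ (suc n) f = f 0 + ∑ n (f ∘ suc)

∑-cong : ∀ n {f g : ℕ → ℕ} → (∀ i → f i ≡ g i) → ∑ n f ≡ ∑ n g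
∑-cong zero    f≡g = refl
∑-cong (suc n) f≡g = cong₂ _+_ (f≡g 0) (∑-cong n (f≡g ∘ suc))

∑-mono : ∀ n {f g : ℕ → ℕ} → (∀ i → f i ≤ g i) → ∑ n f ≤ ∑ n g
∑-mono zero    f≤g = z≤n
∑-mono (suc n) f≤g = +-mono-≤ (f≤g 0) (∑-mono n (f≤g ∘ suc))

∑-const : ∀ n k → ∑ n (λ _ → k) ≡ n * k
∑-const zero    k = refl
∑-const (suc n) k = cong (k +_) (∑-const n k)

∑-+ : ∀ n (f g : ℕ → ℕ) → ∑ n (λ i → f i + g i) ≡ ∑ n f + ∑ n g
∑-+ zero    f g = refl
∑-+ (suc n) f g = trans (cong (f 0 + g 0 +_) (∑-+ n (f ∘ suc) (g ∘ suc)))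
  (+-interchange (f 0) (g 0) (∑ n (f ∘ suc)) (∑ n (g ∘ suc)))
  where
  +-interchange : ∀ a b c d → a + b + (c + d) ≡ a + c + (b + d)
  +-interchange = solve-∀

∑-last : ∀ n (f : ℕ → ℕ) → ∑ (suc n) f ≡ f n + ∑ n f
∑-last zero    f = refl
∑-last (suc n) f = trans (cong (f 0 +_) (∑-last n (f ∘ suc))) (swap (f 0) (f (suc n)) _)
  where
  swap : ∀ a b c → a + (b + c) ≡ b + (a + c)
  swap = solve-∀

-- Sliding the window by one drops the term `f k` and gains `f (n + k)`, which is equal to it by
-- periodicity. The sum of n + 1 terms, split at its first or at its last term, compares the two
-- windows.
∑-shift : ∀ n (f : ℕ → ℕ) → (∀ i → f (i + n) ≡ f i) → ∀ k → ∑ n (λ i → f (i + k)) ≡ ∑ n f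
∑-shift n f periodic zero    = ∑-cong n (λ i → cong f (+-identityʳ i))
∑-shift n f periodic (suc k) = +-cancelˡ-≡ (f k) _ _ (begin
  f k + ∑ n (λ i → f (i + suc k)) ≡⟨ cong (f k +_) (∑-cong n (λ i → cong f (+-suc i k))) ⟩
  ∑ (suc n) (λ i → f (i + k))     ≡⟨ ∑-last n (λ i → f (i + k)) ⟩
  f (n + k) + ∑ n (λ i → f (i + k)) ≡⟨ cong₂ _+_ (trans (cong f (+-comm n k)) (periodic k)) (∑-shift n f periodic k) ⟩
  f k + ∑ n f ∎)
  where open ≡-Reasoning

-- Codes as periodic functions, and double counting.

indicator : Bool → ℕ
indicator b = if b then 1 else 0

∣∣≡∑ : ∀ {n} (C : Subset n) (f : ℕ → ℕ) → (∀ i → f (toℕ i) ≡ indicator (lookup C i)) → ∣ C ∣ ≡ ∑ n f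
∣∣≡∑ []          f h = refl
∣∣≡∑ (true  ∷ C) f h = cong₂ _+_ (sym (h fzero)) (∣∣≡∑ C (f ∘ suc) (h ∘ fsuc))
∣∣≡∑ (false ∷ C) f h = cong₂ _+_ (sym (h fzero)) (∣∣≡∑ C (f ∘ suc) (h ∘ fsuc))

module Characteristic (n : ℕ) .{{_ : NonZero n}} (C : Subset n) where
  open Congruence n

  vertex : ℕ → Fin n
  vertex i = fromℕ< (m%n<n i n)

  toℕ-vertex : ∀ i → toℕ (vertex i) ≈ i
  toℕ-vertex i = trans (≡⇒≈ (toℕ-fromℕ< (m%n<n i n))) (m%n%n≡m%n i n)

  vertex-cong : ∀ {i u} → i ≈ toℕ u → vertex i ≡ u
  vertex-cong {i} {u} i≈u = toℕ-injective
    (≈⇒≡ (toℕ<n _) (toℕ<n u) (trans (toℕ-vertex i) i≈u))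

  -- The code is extended n-periodically to ℕ, so that translating a window is plain addition.
  χ : ℕ → Bool
  χ i = lookup C (vertex i)

  χ-∈ : ∀ {i u} → i ≈ toℕ u → u ∈ C → T (χ i)
  χ-∈ i≈u u∈C = Equivalence.from T-≡ (trans (cong (lookup C) (vertex-cong i≈u)) ([]=⇒lookup u∈C))

  weight : List ℕ → ℕ → ℕ
  weight ts m = sum (map (λ t → indicator (χ (m + t))) ts)

  private
    size : ∣ C ∣ ≡ ∑ n (indicator ∘ χ)
    size = ∣∣≡∑ C _ (λ i → cong (indicator ∘ lookup C) (vertex-cong refl))

    periodic : ∀ i → indicator (χ (i + n)) ≡ indicator (χ i)
    periodic i = cong (indicator ∘ lookup C) (vertex-cong (trans
      (trans (≡⇒≈ (cong (i +_) (sym (*-identityˡ n)))) ([m+kn]%n≡m%n i 1 n))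
      (sym (toℕ-vertex i))))

  -- Each entry of `ts`, counted with multiplicity, contributes the sum of one translate of the
  -- periodic indicator, that is, the size of `C`.
  ∑-weight : ∀ ts → ∑ n (weight ts) ≡ length ts * ∣ C ∣
  ∑-weight []       = trans (∑-const n 0) (*-zeroʳ n)
  ∑-weight (t ∷ ts) = trans (∑-+ n _ (weight ts)) (cong₂ _+_
    (trans (∑-shift n _ periodic t) (sym size)) (∑-weight ts))

  weight≥⇒ : ∀ ts k → (∀ m → k ≤ weight ts m) → n * k ≤ length ts * ∣ C ∣
  weight≥⇒ ts k h = ≤-trans (≤-reflexive (sym (∑-const n k)))
    (≤-trans (∑-mono n h) (≤-reflexive (∑-weight ts)))

  weight≡⇒ : ∀ ts k → (∀ m → weight ts m ≡ k) → length ts * ∣ C ∣ ≡ n * k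
  weight≡⇒ ts k h = trans (sym (∑-weight ts)) (trans (∑-cong n h) (∑-const n k))

-- Linear forms in e and their coefficientwise comparison.

-- (α , β) stands for α + β e, where d = 4 + e.
Form : Set
Form = ℕ × ℕ

eval : ℕ → Form → ℕ
eval e (α , β) = α + β * e

infixl 6 _⊕_ _⊖_
infix 4 _⊑_ _≟F_ _⊑?_

_⊕_ _⊖_ : Form → Form → Form
(α , β) ⊕ (α′ , β′) = (α + α′ , β + β′)
(α , β) ⊖ (α′ , β′) = (α ∸ α′ , β ∸ β′)

-- These conditions are decidable from the coefficients and settle the comparison of values for all
-- `e` at once. Strictness is asked of the constant term, since `e` may be 0.
_⊑_ Below Apart : Form → Form → Set
(α , β) ⊑ (α′ , β′) = α ≤ α′ × β ≤ β′
Below (α , β) (α′ , β′) = α < α′ × β ≤ β′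
Apart f g = Below f g ⊎ Below g f

_≟F_ : (f g : Form) → Dec (f ≡ g)
_≟F_ = ≡-dec _≟_ _≟_

_⊑?_ : (f g : Form) → Dec (f ⊑ g)
(α , β) ⊑? (α′ , β′) = (α ≤? α′) ×-dec (β ≤? β′)

below? : (f g : Form) → Dec (Below f g)
below? (α , β) (α′ , β′) = (α <? α′) ×-dec (β ≤? β′)

apart? : (f g : Form) → Dec (Apart f g)
apart? f g = below? f g ⊎-dec below? g f

eval-⊕ : ∀ e f g → eval e (f ⊕ g) ≡ eval e f + eval e g
eval-⊕ e (α , β) (α′ , β′) = lemma α β α′ β′ e
  where
  lemma : ∀ α β α′ β′ e → α + α′ + (β + β′) * e ≡ α + β * e + (α′ + β′ * e)
  lemma = solve-∀

eval-⊖ : ∀ e {f g} → g ⊑ f → eval e (f ⊖ g) + eval e g ≡ eval e f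
eval-⊖ e {f} {g} (p , q) = trans (sym (eval-⊕ e (f ⊖ g) g))
  (cong (eval e) (cong₂ _,_ (m∸n+n≡m p) (m∸n+n≡m q)))

eval-⊑ : ∀ e {f g} → f ⊑ g → eval e f ≤ eval e g
eval-⊑ e (p , q) = +-mono-≤ p (*-monoˡ-≤ e q)

eval-apart : ∀ e {f g} → Apart f g → ¬ (eval e f ≡ eval e g)
eval-apart e (inj₁ (p , q)) eq = <⇒≢ (+-mono-<-≤ p (*-monoˡ-≤ e q)) eq
eval-apart e (inj₂ (p , q)) eq = <⇒≢ (+-mono-<-≤ p (*-monoˡ-≤ e q)) (sym eq)

-- Decidable conditions on offsets for both bounds.

-- The closed neighbourhood of u consists of the vertices u + o − K with o an offset;
-- the shift by K keeps the offsets nonnegative.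
module Offsets (K : Form) where

  offsets : List Form → List Form
  offsets []       = K ∷ []
  offsets (g ∷ gs) = K ⊕ g ∷ K ⊖ g ∷ offsets gs

  offsets-≤ : ∀ e gs → All (_⊑ K) gs → All (λ o → eval e o ≤ eval e K + eval e K) (offsets gs)
  offsets-≤ e []       []             = m≤m+n _ _ ∷ []
  offsets-≤ e (g ∷ gs) (g⊑K ∷ gs⊑K) =
    ≤-trans (≤-reflexive (eval-⊕ e K g)) (+-monoʳ-≤ (eval e K) (eval-⊑ e {g} {K} g⊑K))
    ∷ ≤-trans (eval-⊑ e {K ⊖ g} {K} (m∸n≤m (proj₁ K) (proj₁ g) , m∸n≤m (proj₂ K) (proj₂ g))) (m≤m+n _ _)
    ∷ offsets-≤ e gs gs⊑K

  module _ (gens : List Form) where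

    -- The center itself has offset `K`, and `v` is the offset of the other vertex. The equation
    -- says that the vertex at offset `o` from the center is at offset `o′` from that other vertex.
    CoveredUpTo : Form → List Form → Form → Set
    CoveredUpTo v ts o = o ∈ˡ ts ⊎ Any (λ o′ → o ⊕ K ≡ v ⊕ o′) (offsets gens)

    -- N[center] ∖ N[v] is contained in the vertices at offsets ts.
    Hitting : Form → List Form → Set
    Hitting v ts = v ⊑ K ⊕ K × Apart K v × All (CoveredUpTo v ts) (offsets gens)

    hitting? : ∀ v ts → Dec (Hitting v ts)
    hitting? v ts = (v ⊑? K ⊕ K) ×-dec apart? K v ×-dec
      all? (λ o → any? (o ≟F_) ts ⊎-dec any? (λ o′ → o ⊕ K ≟F v ⊕ o′) (offsets gens)) (offsets gens)

    module _ (p : ℕ) .{{_ : NonZero p}} (s : ℕ) where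

      -- For e ≡ s and u ≡ r, the neighbour of u at offset a is a multiple of p.
      Coded : ℕ → Form → Set
      Coded r a = (r + eval s a) % p ≡ eval s K % p

      -- The codeword at offset `a₁` from u is tried first. If v sees it at offset `o₁`, then either
      -- `o₁ ≡ a₁`, which forces v = u, or a second codeword, at offset `a`, is out of reach of v:
      -- seeing it at offset `o` would give o₁ + a = o + a₁.
      Separable : ℕ → Set
      Separable r = Any (λ a₁ → Coded r a₁ × All (λ o₁ → o₁ ≡ a₁ ⊎
        Any (λ a → Coded r a × All (λ o → Apart (o₁ ⊕ a) (o ⊕ a₁)) (offsets gens)) (offsets gens))
        (offsets gens)) (offsets gens)

      separable? : ∀ r → Dec (Separable r)
      separable? r = any? (λ a₁ → ((r + eval s a₁) % p ≟ eval s K % p) ×-dec all? (λ o₁ → (o₁ ≟F a₁) ⊎-dec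
        any? (λ a → ((r + eval s a) % p ≟ eval s K % p) ×-dec
          all? (λ o → apart? (o₁ ⊕ a) (o ⊕ a₁)) (offsets gens)) (offsets gens))
        (offsets gens)) (offsets gens)

-- Circulant adjacency in terms of offsets.

module Codes (n : ℕ) .{{_ : NonZero n}} (e : ℕ) (K : Form) (gens : List Form)
             (gens⊑K : All (_⊑ K) gens)
             (4K<n : eval e K + eval e K + (eval e K + eval e K) < n) where
  open Congruence n
  open Offsets K

  G : Graph n
  G = Circulant n (map (eval e) gens)

  private
    k : ℕ
    k = eval e K

    offset-≤ : ∀ {o} → o ∈ˡ offsets gens → eval e o ≤ k + k
    offset-≤ = All.lookup (offsets-≤ e gens gens⊑K)

    Reaches : List Form → ℕ → ℕ → Set
    Reaches gs u v = Any (λ o → u + eval e o ≈ v + k) (offsets gs)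

    Step : ℕ → ℕ → ℕ → Set
    Step u v d = (∃[ j ] (u + d ≡ v + j * n)) ⊎ (∃[ j ] (v + d ≡ u + j * n))

    unwind : ∀ {a v} → ∃[ j ] (a ≡ v + j * n) → a ≈ v
    unwind {v = v} (j , eq) = trans (≡⇒≈ eq) ([m+kn]%n≡m%n v j n)

    wind : ∀ {a} (v : Fin n) → a ≈ toℕ v → ∃[ j ] (a ≡ toℕ v + j * n)
    wind {a} v a≈v = a / n , trans (m≡m%n+[m/n]*n a n)
      (cong (_+ a / n * n) (trans a≈v (m<n⇒m%n≡m (toℕ<n v))))

    forward : ∀ g u → u + eval e (K ⊕ g) ≡ u + eval e g + k
    forward g u = trans (cong (u +_) (trans (eval-⊕ e K g) (+-comm k _))) (sym (+-assoc u _ k))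

    backward : ∀ {g} → g ⊑ K → ∀ u → u + eval e g + eval e (K ⊖ g) ≡ u + k
    backward {g} g⊑K u = trans (+-assoc u _ _)
      (cong (u +_) (trans (+-comm (eval e g) _) (eval-⊖ e {K} {g} g⊑K)))

    stay : ∀ gs {u v} → u ≈ v → Reaches gs u v
    stay []       {u} {v} u≈v = here (+-cong-≈ {u} {v} u≈v refl)
    stay (g ∷ gs) u≈v = there (there (stay gs u≈v))

    step⇒reaches : ∀ gs → All (_⊑ K) gs → ∀ {u v} → Any (Step u v) (map (eval e) gs) → Reaches gs u v
    step⇒reaches (g ∷ gs) (g⊑K ∷ _) {u} {v} (here (inj₁ s)) =
      here (trans (≡⇒≈ (forward g u)) (+-cong-≈ {u + eval e g} {v} (unwind s) refl))
    step⇒reaches (g ∷ gs) (g⊑K ∷ _) {u} {v} (here (inj₂ s)) =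
      there (here (trans (+-cong-≈ {u} {v + eval e g} (sym (unwind s)) refl) (≡⇒≈ (backward {g} g⊑K v))))
    step⇒reaches (g ∷ gs) (_ ∷ gs⊑K) (there s) = there (there (step⇒reaches gs gs⊑K s))

    reaches⇒step : ∀ gs → All (_⊑ K) gs → (u v : Fin n) → Reaches gs (toℕ u) (toℕ v) →
      u ≡ v ⊎ Any (Step (toℕ u) (toℕ v)) (map (eval e) gs)
    reaches⇒step [] [] u v (here h) =
      inj₁ (toℕ-injective (≈⇒≡ (toℕ<n u) (toℕ<n v) (+-cancelʳ-≈ k h)))
    reaches⇒step (g ∷ gs) _ u v (here h) =
      inj₂ (here (inj₁ (wind v (+-cancelʳ-≈ k (trans (≡⇒≈ (sym (forward g (toℕ u)))) h)))))
    reaches⇒step (g ∷ gs) (g⊑K ∷ _) u v (there (here h)) =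
      inj₂ (here (inj₂ (wind u (+-cancelʳ-≈ (eval e (K ⊖ g))
        (trans (≡⇒≈ (backward {g} g⊑K (toℕ v))) (sym h))))))
    reaches⇒step (g ∷ gs) (_ ∷ gs⊑K) u v (there (there h)) with reaches⇒step gs gs⊑K u v h
    ... | inj₁ u≡v = inj₁ u≡v
    ... | inj₂ s   = inj₂ (there s)

    near⇒reaches : ∀ u v → InClosedNbhd G u v → Reaches gens (toℕ u) (toℕ v)
    near⇒reaches u v (inj₁ u≡v)     = stay gens (≡⇒≈ (cong toℕ u≡v))
    near⇒reaches u v (inj₂ (_ , s)) = step⇒reaches gens gens⊑K s

    reaches⇒near : ∀ u v → Reaches gens (toℕ u) (toℕ v) → InClosedNbhd G u v
    -- `CircAdj` demands distinct endpoints, which a step alone does not record.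
    reaches⇒near u v h with u ≟ᶠ v
    ... | yes u≡v = inj₁ u≡v
    ... | no  u≢v with reaches⇒step gens gens⊑K u v h
    ...   | inj₁ u≡v = contradiction u≡v u≢v
    ...   | inj₂ s   = inj₂ (u≢v , s)

    reaches? : ∀ u v → Dec (Reaches gens u v)
    reaches? u v = any? (λ o → (u + eval e o) % n ≟ (v + k) % n) (offsets gens)

  -- Local constraints on a self-identifying code.

  module LowerBound (C : Subset n) (sid : SelfIdentifying G C) where
    open Characteristic n C public

    -- The codeword in N[center] ∖ N[mover] must have its offset in `ts`, by the computed check. The
    -- base `b` places the center at m + b + K, so that constraints around different centers share
    -- one frame.
    hit : ∀ v ts → {True (hitting? gens v ts)} → ∀ b m →
      T (any (λ t → χ (m + eval e (b ⊕ t))) ts)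
    hit v ts {check} b m = any⁺ _ found
      where
      m′ : ℕ
      m′ = m + eval e b
      facts : Hitting gens v ts
      facts = toWitness check
      2K<n : k + k < n
      2K<n = ≤-<-trans (m≤m+n (k + k) (k + k)) 4K<n
      center mover : Fin n
      center = vertex (m′ + k)
      mover  = vertex (m′ + eval e v)
      distinct : ¬ (center ≡ mover)
      -- Both positions are at most 2K < n, so a congruence between them would be an equality, which
      -- `Apart` excludes.
      distinct eq = eval-apart e {K} {v} (proj₁ (proj₂ facts)) (≈⇒≡
        (≤-<-trans (m≤m+n k k) 2K<n)
        (≤-<-trans (≤-trans (eval-⊑ e {v} {K ⊕ K} (proj₁ facts)) (≤-reflexive (eval-⊕ e K K))) 2K<n)
        (+-cancelʳ-≈ m′ (trans (≡⇒≈ (+-comm k m′)) (trans (sym (toℕ-vertex (m′ + k)))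
          (trans (≡⇒≈ (cong toℕ eq)) (trans (toℕ-vertex _) (≡⇒≈ (+-comm m′ _))))))))
      found : Any (λ t → T (χ (m + eval e (b ⊕ t)))) ts
      found with proj₂ sid center mover distinct
      ... | c , c∈C , near , ¬near with find (near⇒reaches center c near)
      ...   | o , o∈ , reach = go (All.lookup (proj₂ (proj₂ facts)) o∈)
        where
        c≈ : m′ + eval e o ≈ toℕ c
        c≈ = +-cancelʳ-≈ k (trans (≡⇒≈ (+-swapʳ m′ (eval e o) k))
          (trans (+-cong-≈ {m′ + k} {toℕ center} (sym (toℕ-vertex _)) refl) reach))
        at : ∀ {t} → o ≡ t → T (χ (m + eval e (b ⊕ t)))
        at refl = χ-∈ (trans (≡⇒≈ (trans (cong (m +_) (eval-⊕ e b o)) (sym (+-assoc m _ _)))) c≈) c∈C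
        back : ∀ {o′} → o ⊕ K ≡ v ⊕ o′ → toℕ mover + eval e o′ ≈ toℕ c + k
        back {o′} eq = trans (+-cong-≈ {toℕ mover} {m′ + eval e v} (toℕ-vertex _) refl)
          (trans (≡⇒≈ (trans (+-assoc m′ _ _) (trans (cong (m′ +_)
            (trans (sym (eval-⊕ e v o′)) (trans (cong (eval e) (sym eq)) (eval-⊕ e o K))))
            (sym (+-assoc m′ _ k)))))
            (+-cong-≈ {m′ + eval e o} {toℕ c} c≈ refl))
        go : CoveredUpTo gens v ts o → Any (λ t → T (χ (m + eval e (b ⊕ t)))) ts
        go (inj₁ o∈ts) = Any.map at o∈ts
        go (inj₂ o′∈)  = ⊥-elim (¬near (reaches⇒near mover c (Any.map (λ {o′} → back {o′}) o′∈)))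

  -- The multiples of p form a self-identifying code.

  module UpperBound (p : ℕ) .{{_ : NonZero p}} (p∣n : p ∣ n)
                    (separable : All (Separable gens p (e % p)) (upTo p)) where
    module Modₚ = Congruence p
    open Modₚ using () renaming (_≈_ to _≈ₚ_)

    multiples : Subset n
    multiples = tabulate (λ i → does (toℕ i % p ≟ 0))

    open Characteristic n multiples public

    private
      0∈ : ∀ {c} → toℕ c % p ≡ 0 → c ∈ multiples
      0∈ {c} eq = lookup⇒[]= c multiples
        (trans (lookup∘tabulate _ c) (dec-true (toℕ c % p ≟ 0) eq))

      -- Here `p ∣ n` enters: residues modulo `p` survive reduction modulo `n`, so the multiples of
      -- `p` go around the cycle without a seam.
      ≈⇒≈ₚ : ∀ {a b} → a ≈ b → a ≈ₚ b
      ≈⇒≈ₚ {a} {b} a≈b = trans (sym (m∣n⇒o%n%m≡o%m p n a p∣n)) (trans (cong (_% p) a≈b) (m∣n⇒o%n%m≡o%m p n b p∣n))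

      eval-≈ₚ : ∀ f → eval e f ≈ₚ eval (e % p) f
      eval-≈ₚ (α , β) = Modₚ.+-cong-≈ {α} refl (Modₚ.*-cong-≈ {β} refl (Modₚ.%-≈ e))

    χ-multiples : ∀ m → χ m ≡ does (m % p ≟ 0)
    χ-multiples m = trans (lookup∘tabulate _ (vertex m))
      (cong (λ r → does (r ≟ 0)) (≈⇒≈ₚ (toℕ-vertex m)))

    module _ (u : Fin n) where
      private
        -- The vertex u + a - K, with `k * pred n` in the place of -K.
        codeword : Form → Fin n
        codeword a = vertex (toℕ u + eval e a + k * pred n)

        codeword-≈ : ∀ a → toℕ (codeword a) + k ≈ toℕ u + eval e a
        codeword-≈ a = trans (+-cong-≈ {toℕ (codeword a)} (toℕ-vertex _) (refl {x = k % n}))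
          (trans (≡⇒≈ (+-swapʳ (toℕ u + eval e a) (k * pred n) k)) (+-inverse-≈ (toℕ u + eval e a) k))

        codeword-∈ : ∀ a → Coded gens p (e % p) (toℕ u % p) a → codeword a ∈ multiples
        codeword-∈ a coded = 0∈ (trans (Modₚ.+-cancelʳ-≈ k (trans (≈⇒≈ₚ (codeword-≈ a))
          (trans (Modₚ.+-cong-≈ {toℕ u} (Modₚ.%-≈ (toℕ u)) (eval-≈ₚ a))
            (trans coded (sym (eval-≈ₚ K)))))) (m*n%n≡0 0 p))

        reaches-codeword : ∀ a → a ∈ˡ offsets gens → Reaches gens (toℕ u) (toℕ (codeword a))
        reaches-codeword a a∈ = Any.map (λ where refl → sym (codeword-≈ a)) a∈

      separate : ∀ v → ¬ (u ≡ v) →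
        ∃[ c ] (c ∈ multiples × InClosedNbhd G u c × ¬ InClosedNbhd G v c)
      separate v u≢v with find (All.lookup separable (∈-upTo⁺ (m%n<n (toℕ u) p)))
      ... | a₁ , a₁∈ , coded₁ , resolve with reaches? (toℕ v) (toℕ (codeword a₁))
      ...   | no ¬reach = codeword a₁ , codeword-∈ a₁ coded₁
                , reaches⇒near u _ (reaches-codeword a₁ a₁∈) , ¬reach ∘ near⇒reaches v _
      ...   | yes reach with find reach
      ...     | o₁ , o₁∈ , v→c₁ with All.lookup resolve o₁∈
      ...       | inj₁ refl = contradiction (toℕ-injective (≈⇒≡ (toℕ<n u) (toℕ<n v)
                    (+-cancelʳ-≈ (eval e a₁) (trans (sym (codeword-≈ a₁)) (sym v→c₁))))) u≢v
      ...       | inj₂ other with find other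
      ...         | a , a∈ , coded , apart = codeword a , codeword-∈ a coded
                      , reaches⇒near u _ (reaches-codeword a a∈) , ¬near
        where
        ¬near : ¬ InClosedNbhd G v (codeword a)
        ¬near near with find (near⇒reaches v _ near)
        ... | o , o∈ , v→c = eval-apart e {o₁ ⊕ a} {o ⊕ a₁} (All.lookup apart o∈)
          (trans (eval-⊕ e o₁ a) (trans exact (sym (eval-⊕ e o a₁))))
          where
          x = toℕ u
          y = toℕ v
          -- With c₁ and c the two codewords, v + o₁ ≈ c₁ + K ≈ u + a₁ and u + a ≈ c + K ≈ v + o.
          -- These are added and u + v is cancelled.
          balance : eval e o₁ + eval e a ≈ eval e o + eval e a₁
          balance = +-cancelʳ-≈ (y + x) (trans (≡⇒≈ (shuffle (eval e o₁) (eval e a) y x))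
            (trans (+-cong-≈ {y + eval e o₁} {x + eval e a₁} (trans v→c₁ (codeword-≈ a₁))
                             (sym (trans v→c (codeword-≈ a))))
              (≡⇒≈ (unshuffle (eval e o) (eval e a₁) y x))))
            where
            shuffle : ∀ p q y x → p + q + (y + x) ≡ y + p + (x + q)
            shuffle = solve-∀
            unshuffle : ∀ p q y x → x + q + (y + p) ≡ p + q + (y + x)
            unshuffle = solve-∀
          exact : eval e o₁ + eval e a ≡ eval e o + eval e a₁
          exact = ≈⇒≡ (≤-<-trans (+-mono-≤ (offset-≤ o₁∈) (offset-≤ a∈)) 4K<n)
                      (≤-<-trans (+-mono-≤ (offset-≤ o∈) (offset-≤ a₁∈)) 4K<n) balance

    multiples-sid : SelfIdentifying G multiples
    multiples-sid = (vertex 0 , 0∈ (trans (≈⇒≈ₚ (toℕ-vertex 0)) (m*n%n≡0 0 p))) , separate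

  -- Both bounds count a window over all n translates. The window 0, ..., p - 1 always holds exactly
  -- one multiple of `p`; the window `fs`, of jp entries, always holds at least `j` codewords.
  minimum : ∀ p .{{_ : NonZero p}} → n % p ≡ 0 →
    All (Separable gens p (e % p)) (upTo p) →
    (∀ m → sum (map (λ t → indicator (does ((m + t) % p ≟ 0))) (upTo p)) ≡ 1) →
    (fs : List Form) (j : ℕ) .{{_ : NonZero j}} → length fs ≡ j * p →
    (∀ C → SelfIdentifying G C → ∀ m → j ≤ Characteristic.weight n C (map (eval e) fs) m) →
    γSID≡ G (n / p)
  minimum p p∣n separable one fs j len local =
    (multiples , multiples-sid , *-cancelˡ-≡ _ _ p size) , bound
    where
    open UpperBound p (m%n≡0⇒n∣m n p p∣n) separable
    n≡ : n ≡ p * (n / p)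
    n≡ = trans (m≡m%n+[m/n]*n n p) (trans (cong (_+ n / p * p) p∣n) (*-comm (n / p) p))
    size : p * ∣ multiples ∣ ≡ p * (n / p)
    size = begin
      p * ∣ multiples ∣               ≡⟨ cong (_* ∣ multiples ∣) (length-upTo p) ⟨
      length (upTo p) * ∣ multiples ∣ ≡⟨ weight≡⇒ (upTo p) 1 (λ m → trans
        (cong sum (map-cong (λ t → cong indicator (χ-multiples (m + t))) (upTo p))) (one m)) ⟩
      n * 1                           ≡⟨ *-identityʳ n ⟩
      n                               ≡⟨ n≡ ⟩
      p * (n / p)                     ∎
      where open ≡-Reasoning
    bound : ∀ C → SelfIdentifying G C → n / p ≤ ∣ C ∣
    bound C sid = *-cancelˡ-≤ p (*-cancelˡ-≤ j (begin
      j * (p * (n / p))               ≡⟨ cong (j *_) n≡ ⟨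
      j * n                           ≡⟨ *-comm j n ⟩
      n * j                           ≤⟨ Characteristic.weight≥⇒ n C (map (eval e) fs) j (local C sid) ⟩
      length (map (eval e) fs) * ∣ C ∣ ≡⟨ cong (_* ∣ C ∣) (trans (length-map (eval e) fs) len) ⟩
      j * p * ∣ C ∣                   ≡⟨ *-assoc j p ∣ C ∣ ⟩
      j * (p * ∣ C ∣)                 ∎))
      where open ≤-Reasoning

-- Counting inside a single window.

one-even : ∀ m → sum (map (λ t → indicator (does ((m + t) % 2 ≟ 0))) (upTo 2)) ≡ 1
one-even 0             = refl
one-even 1             = refl
one-even (suc (suc m)) = one-even m

one-multiple-of-3 : ∀ m → sum (map (λ t → indicator (does ((m + t) % 3 ≟ 0))) (upTo 3)) ≡ 1
one-multiple-of-3 0                   = refl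
one-multiple-of-3 1                   = refl
one-multiple-of-3 2                   = refl
one-multiple-of-3 (suc (suc (suc m))) = one-multiple-of-3 m

one-of-three : ∀ a b c → T (a ∨ b ∨ c ∨ false) → 1 ≤ indicator a + indicator b + indicator c
one-of-three true  b     c    _ = s≤s z≤n
one-of-three false true  c    _ = s≤s z≤n
one-of-three false false true _ = s≤s z≤n

two-of-three : ∀ a b c → T (a ∨ b ∨ false) → T (b ∨ c ∨ false) → T (c ∨ a ∨ false) →
  2 ≤ indicator a + indicator b + indicator c
two-of-three true  true  c    _ _ _ = s≤s (s≤s z≤n)
two-of-three true  false true _ _ _ = s≤s (s≤s z≤n)
two-of-three false true  true _ _ _ = s≤s (s≤s z≤n)

-- With at most one codeword among the four, some three of the others would form a triple that is
-- missed.
two-of-four : ∀ a b c d → T (a ∨ b ∨ d ∨ false) → T (a ∨ c ∨ d ∨ false) →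
  T (a ∨ b ∨ c ∨ false) → T (b ∨ c ∨ d ∨ false) →
  2 ≤ sum (map indicator (a ∷ b ∷ c ∷ d ∷ []))
two-of-four true  true  _    _    _ _ _ _ = s≤s (s≤s z≤n)
two-of-four true  false true _    _ _ _ _ = s≤s (s≤s z≤n)
two-of-four true  false false true _ _ _ _ = s≤s (s≤s z≤n)
two-of-four false true  true _    _ _ _ _ = s≤s (s≤s z≤n)
two-of-four false true  false true _ _ _ _ = s≤s (s≤s z≤n)
two-of-four false false true true _ _ _ _ = s≤s (s≤s z≤n)

-- If `y` is a codeword, it counts twice and the two halves of the hexagon give one each. Otherwise
-- the triples through `y` become pairs: they hit every pair of the even corners and every pair of
-- the odd corners, so each class has two codewords.
four-of-hexagon : ∀ y h₀ h₁ h₂ h₃ h₄ h₅ →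
  T (h₀ ∨ h₁ ∨ h₂ ∨ false) → T (h₃ ∨ h₄ ∨ h₅ ∨ false) →
  T (y ∨ h₀ ∨ h₂ ∨ false) → T (y ∨ h₂ ∨ h₄ ∨ false) → T (y ∨ h₄ ∨ h₀ ∨ false) →
  T (y ∨ h₁ ∨ h₃ ∨ false) → T (y ∨ h₃ ∨ h₅ ∨ false) → T (y ∨ h₅ ∨ h₁ ∨ false) →
  4 ≤ sum (map indicator (y ∷ y ∷ h₀ ∷ h₁ ∷ h₂ ∷ h₃ ∷ h₄ ∷ h₅ ∷ []))
four-of-hexagon true h₀ h₁ h₂ h₃ h₄ h₅ p q _ _ _ _ _ _ = s≤s (s≤s
  (subst (2 ≤_) (regroup (indicator h₀) (indicator h₁) (indicator h₂) (indicator h₃) (indicator h₄) (indicator h₅))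
    (+-mono-≤ (one-of-three h₀ h₁ h₂ p) (one-of-three h₃ h₄ h₅ q))))
  where
  regroup : ∀ a b c d e f → a + b + c + (d + e + f) ≡ a + (b + (c + (d + (e + (f + 0)))))
  regroup = solve-∀
four-of-hexagon false h₀ h₁ h₂ h₃ h₄ h₅ _ _ p₁ p₂ p₃ q₁ q₂ q₃ =
  subst (4 ≤_) (regroup (indicator h₀) (indicator h₁) (indicator h₂) (indicator h₃) (indicator h₄) (indicator h₅))
    (+-mono-≤ (two-of-three h₀ h₂ h₄ p₁ p₂ p₃) (two-of-three h₁ h₃ h₅ q₁ q₂ q₃))
  where
  regroup : ∀ a b c d e f → a + c + e + (b + d + f) ≡ a + (b + (c + (d + (e + (f + 0)))))
  regroup = solve-∀

-- The three families of circulant graphs.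

[1] [d-1] [d] [d+1] : Form
[1]   = 1 , 0
[d-1] = 3 , 1
[d]   = 4 , 1
[d+1] = 5 , 1

module _ (e n : ℕ) where

  private
    4d<n : 4 * (4 + e) + 1 ≤ n → eval e [d] + eval e [d] + (eval e [d] + eval e [d]) < n
    4d<n = ≤-trans (≤-reflexive (expand e))
      where
      expand : ∀ e → suc ((4 + 1 * e) + (4 + 1 * e) + ((4 + 1 * e) + (4 + 1 * e))) ≡ 4 * (4 + e) + 1
      expand = solve-∀

    4d+4<n : 4 * (4 + e) + 5 ≤ n → eval e [d+1] + eval e [d+1] + (eval e [d+1] + eval e [d+1]) < n
    4d+4<n = ≤-trans (≤-reflexive (expand e))
      where
      expand : ∀ e → suc ((5 + 1 * e) + (5 + 1 * e) + ((5 + 1 * e) + (5 + 1 * e))) ≡ 4 * (4 + e) + 5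
      expand = solve-∀

  -- The four offsets (0 , 0), (3 , 1), (5 , 1), (8 , 2) are −d, −1, 1, d, shifted by d.
  γSID-1-d : e % 2 ≡ 0 → 4 * (4 + e) + 1 ≤ n → n % 2 ≡ 0 →
    γSID≡ (Circulant n (map (eval e) ([1] ∷ [d] ∷ []))) (n / 2)
  γSID-1-d e-even n-large n-even =
    minimum 2 n-even separable one-even ((0 , 0) ∷ (3 , 1) ∷ (5 , 1) ∷ (8 , 2) ∷ []) 2 refl local
    where
    gens = [1] ∷ [d] ∷ []
    instance
      n≢0 : NonZero n
      n≢0 = >-nonZero (≤-<-trans z≤n (4d<n n-large))
    open Codes n e [d] gens (toWitness {a? = all? (_⊑? [d]) gens} _) (4d<n n-large)
    separable : All (Offsets.Separable [d] gens 2 (e % 2)) (upTo 2)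
    separable = subst (λ s → All (Offsets.Separable [d] gens 2 s) (upTo 2)) (sym e-even)
      (toWitness {a? = all? (Offsets.separable? [d] gens 2 0) (upTo 2)} _)
    local : ∀ C → SelfIdentifying G C → ∀ m → 2 ≤ Characteristic.weight n C
      (map (eval e) ((0 , 0) ∷ (3 , 1) ∷ (5 , 1) ∷ (8 , 2) ∷ [])) m
    local C sid m = two-of-four (c (0 , 0)) (c (3 , 1)) (c (5 , 1)) (c (8 , 2))
      -- The moves are from u to u + 1, u - 1, u + d and u - d; each triple omits the neighbour
      -- moved to.
      (hit (5 , 1) ((0 , 0) ∷ (3 , 1) ∷ (8 , 2) ∷ []) (0 , 0) m)
      (hit (3 , 1) ((0 , 0) ∷ (5 , 1) ∷ (8 , 2) ∷ []) (0 , 0) m)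
      (hit (8 , 2) ((0 , 0) ∷ (3 , 1) ∷ (5 , 1) ∷ []) (0 , 0) m)
      (hit (0 , 0) ((3 , 1) ∷ (5 , 1) ∷ (8 , 2) ∷ []) (0 , 0) m)
      where
      open LowerBound C sid
      c : Form → Bool
      c f = χ (m + eval e f)

  γSID-1-d-1-d : 4 * (4 + e) + 1 ≤ n → n % 2 ≡ 0 →
    γSID≡ (Circulant n (map (eval e) ([1] ∷ [d-1] ∷ [d] ∷ []))) (n / 2)
  γSID-1-d-1-d n-large n-even = minimum 2 n-even (separable (e % 2) (m%n<n e 2)) one-even
    (y ∷ y ∷ h₀ ∷ h₁ ∷ h₂ ∷ h₃ ∷ h₄ ∷ h₅ ∷ []) 4 refl local
    where
    gens = [1] ∷ [d-1] ∷ [d] ∷ []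
    instance
      n≢0 : NonZero n
      n≢0 = >-nonZero (≤-<-trans z≤n (4d<n n-large))
    open Codes n e [d] gens (toWitness {a? = all? (_⊑? [d]) gens} _) (4d<n n-large)
    -- The parity of d is free here, so both residues of `e` are checked.
    separable : ∀ s → s < 2 → All (Offsets.Separable [d] gens 2 s) (upTo 2)
    separable 0 _ = toWitness {a? = all? (Offsets.separable? [d] gens 2 0) (upTo 2)} _
    separable 1 _ = toWitness {a? = all? (Offsets.separable? [d] gens 2 1) (upTo 2)} _
    separable (suc (suc _)) (s≤s (s≤s ()))
    -- The directions 1, d, d - 1, -1, -d, -(d - 1) run around the hexagon, each shifted by d.
    o₀ o₁ o₂ o₃ o₄ o₅ y h₀ h₁ h₂ h₃ h₄ h₅ : Form
    o₀ = [d] ⊕ [1]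
    o₁ = [d] ⊕ [d]
    o₂ = [d] ⊕ [d-1]
    o₃ = [d] ⊖ [1]
    o₄ = [d] ⊖ [d]
    o₅ = [d] ⊖ [d-1]
    -- The second shift by d makes room for the bases of `hit`: base `[d]` has center `y`, and base
    -- `oᵢ` has center `hᵢ`.
    y  = [d] ⊕ [d]
    h₀ = [d] ⊕ o₀
    h₁ = [d] ⊕ o₁
    h₂ = [d] ⊕ o₂
    h₃ = [d] ⊕ o₃
    h₄ = [d] ⊕ o₄
    h₅ = [d] ⊕ o₅
    -- y is a vertex and hᵢ its neighbours in cyclic order. The two triples around y are hit as lost
    -- in a move from y; the triple y, hᵢ₋₁, hᵢ₊₁ is lost in a move from hᵢ away from y.
    local : ∀ C → SelfIdentifying G C → ∀ m → 4 ≤ Characteristic.weight n C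
      (map (eval e) (y ∷ y ∷ h₀ ∷ h₁ ∷ h₂ ∷ h₃ ∷ h₄ ∷ h₅ ∷ [])) m
    local C sid m = four-of-hexagon (c y) (c h₀) (c h₁) (c h₂) (c h₃) (c h₄) (c h₅)
      (hit o₄ (o₀ ∷ o₁ ∷ o₂ ∷ []) [d] m)
      (hit o₁ (o₃ ∷ o₄ ∷ o₅ ∷ []) [d] m)
      (hit o₁ (o₄ ∷ o₅ ∷ o₃ ∷ []) o₁ m)
      (hit o₃ (o₀ ∷ o₁ ∷ o₅ ∷ []) o₃ m)
      (hit o₅ (o₂ ∷ o₃ ∷ o₁ ∷ []) o₅ m)
      (hit o₂ (o₅ ∷ o₀ ∷ o₄ ∷ []) o₂ m)
      (hit o₄ (o₁ ∷ o₂ ∷ o₀ ∷ []) o₄ m)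
      (hit o₀ (o₃ ∷ o₄ ∷ o₂ ∷ []) o₀ m)
      where
      open LowerBound C sid
      c : Form → Bool
      c f = χ (m + eval e f)

  -- The offsets (0 , 0), (4 , 1), (8 , 2) are −d−1, −1, d−1, shifted by d + 1: the column of the
  -- king's grid that is lost in the move from u to u + 1.
  γSID-1-d-1-d-d+1 : e % 3 ≡ 0 → 4 * (4 + e) + 5 ≤ n → n % 3 ≡ 0 →
    γSID≡ (Circulant n (map (eval e) ([1] ∷ [d-1] ∷ [d] ∷ [d+1] ∷ []))) (n / 3)
  γSID-1-d-1-d-d+1 e≡0 n-large 3∣n =
    minimum 3 3∣n separable one-multiple-of-3 ((0 , 0) ∷ (4 , 1) ∷ (8 , 2) ∷ []) 1 refl local
    where
    gens = [1] ∷ [d-1] ∷ [d] ∷ [d+1] ∷ []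
    instance
      n≢0 : NonZero n
      n≢0 = >-nonZero (≤-<-trans z≤n (4d+4<n n-large))
    open Codes n e [d+1] gens (toWitness {a? = all? (_⊑? [d+1]) gens} _) (4d+4<n n-large)
    separable : All (Offsets.Separable [d+1] gens 3 (e % 3)) (upTo 3)
    separable = subst (λ s → All (Offsets.Separable [d+1] gens 3 s) (upTo 3)) (sym e≡0)
      (toWitness {a? = all? (Offsets.separable? [d+1] gens 3 0) (upTo 3)} _)
    local : ∀ C → SelfIdentifying G C → ∀ m → 1 ≤ Characteristic.weight n C
      (map (eval e) ((0 , 0) ∷ (4 , 1) ∷ (8 , 2) ∷ [])) m
    local C sid m = subst (1 ≤_) (regroup (indicator (c (0 , 0))) (indicator (c (4 , 1))) _)
      (one-of-three (c (0 , 0)) (c (4 , 1)) (c (8 , 2))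
        -- `(6 , 1)` is the vertex u + 1, since u itself is at (5 , 1).
        (hit (6 , 1) ((0 , 0) ∷ (4 , 1) ∷ (8 , 2) ∷ []) (0 , 0) m))
      where
      open LowerBound C sid
      c : Form → Bool
      c f = χ (m + eval e f)
      regroup : ∀ a b c → a + b + c ≡ a + (b + (c + 0))
      regroup = solve-∀

-- As d = 4 + e, `d % 3` reduces to `suc e % 3`; so d ≡ 1 becomes e ≡ 0, the residue at which
-- separability is checked.
%3-pred : ∀ e → suc e % 3 ≡ 1 → e % 3 ≡ 0
%3-pred 0                   _  = refl
%3-pred 1                   ()
%3-pred 2                   ()
%3-pred (suc (suc (suc e))) eq = %3-pred e eq

theorem7 : (d : ℕ) → 4 ≤ d →
    ((n : ℕ) → d % 2 ≡ 0 → 4 * d + 1 ≤ n → n % 2 ≡ 0 →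
    γSID≡ (Circulant n (1 ∷ d ∷ [])) (n / 2)) ×
    ((n : ℕ) → 4 * d + 1 ≤ n → n % 2 ≡ 0 →
    γSID≡ (Circulant n (1 ∷ d ∸ 1 ∷ d ∷ [])) (n / 2)) ×
    ((n : ℕ) → d % 3 ≡ 1 → 4 * d + 5 ≤ n → n % 3 ≡ 0 →
    γSID≡ (Circulant n (1 ∷ d ∸ 1 ∷ d ∷ suc d ∷ [])) (n / 3))
theorem7 d 4≤d with m≤n⇒∃[o]m+o≡n 4≤d
... | e , refl =
    -- `eval e [d]` reduces to `4 + (e + 0)`; the substitution removes the `+ 0`.
    (λ n d-even n-large n-even → subst (λ x → γSID≡ (Circulant n (1 ∷ 4 + x ∷ [])) (n / 2))
      (+-identityʳ e) (γSID-1-d e n d-even n-large n-even))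
  , (λ n n-large n-even → subst (λ x → γSID≡ (Circulant n (1 ∷ 3 + x ∷ 4 + x ∷ [])) (n / 2))
      (+-identityʳ e) (γSID-1-d-1-d e n n-large n-even))
  , (λ n d≡1 n-large 3∣n → subst (λ x → γSID≡ (Circulant n (1 ∷ 3 + x ∷ 4 + x ∷ 5 + x ∷ [])) (n / 3))
      (+-identityʳ e) (γSID-1-d-1-d-d+1 e n (%3-pred e d≡1) n-large 3∣n))
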